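{- Let $a_4(n)$ denote the number of $4$-core partitions of $n$. For all $\alpha\ge1$, $\beta\ge0$, $n\ge0$ and $i\in\{1,2\}$, $$a_4\left(3^{2\alpha}n+\frac{(8i+15)\cdot3^{2\alpha-1}-5}{8}\right)\equiv0\pmod2$$ and $$a_4\left(\frac{5\cdot3^{2\beta}-5}{8}\right)\equiv1\pmod2.$$
   Context: A partition is a $t$-core partition if none of its hook lengths is divisible by $t$; $a_t(n)$ is the number of $t$-core partitions of $n$. Its generating function (Garvan–Kim–Stanton) is $\sum_{n\ge0}a_t(n)q^n=\prod_{n\ge1}\frac{(1-q^{tn})^t}{1-q^n}$. -}

module Defs where

open import Data.Empty using (⊥-elim)
open import Data.Fin using (Fin; toℕ)
open import Data.Fin.Properties using (all?)
open import Data.List using (List; []; _∷_; _++_; length; map; filter; drop; lookup)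
open import Data.List.Membership.Propositional using (_∈_)
open import Data.List.Membership.Propositional.Properties
  using (∈-++⁺ˡ; ∈-++⁺ʳ; ∈-++⁻; ∈-map⁺; ∈-map⁻)
open import Data.List.Properties using (∷-injectiveʳ)
open import Data.List.Relation.Unary.All as All using (All; []; _∷_)
import Data.List.Relation.Unary.AllPairs as AllPairs
open import Data.List.Relation.Unary.Any using (here; there)
open import Data.List.Relation.Unary.Linked as Linked using (Linked; []; [-]; _∷_)
open import Data.List.Relation.Unary.Unique.Propositional using (Unique)
import Data.List.Relation.Unary.Unique.Propositional.Properties as Uniqueₚ
open import Data.Nat
open import Data.Nat.DivMod using (m*n/n≡m)
open import Data.Nat.Divisibility using (_∣_; _∣?_)
open import Data.Nat.ListAction using (sum)
open import Data.Nat.Properties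
open import Data.Nat.Tactic.RingSolver using (solve-∀)
open import Data.Product using (_×_; _,_; proj₁; proj₂; ∃)
open import Data.Sum using (inj₁; inj₂)
open import Relation.Binary.PropositionalEquality
open import Relation.Nullary using (¬_; Dec; yes; no; ¬?)

record IsPartition (n : ℕ) (xs : List ℕ) : Set where
  field
    total      : sum xs ≡ n
    positive   : All (0 <_) xs
    decreasing : Linked _≥_ xs

-- Rows and columns are numbered from 0, so the row i of the Young diagram
-- consists of the cells (i , j) with j < lookup xs i.

arm : (xs : List ℕ) → Fin (length xs) → ℕ → ℕ
arm xs i j = lookup xs i ∸ suc j

leg : (xs : List ℕ) → Fin (length xs) → ℕ → ℕ
leg xs i j = length (filter (j <?_) (drop (suc (toℕ i)) xs))

hookLength : (xs : List ℕ) → Fin (length xs) → ℕ → ℕ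
hookLength xs i j = suc (arm xs i j + leg xs i j)

IsCore : ℕ → List ℕ → Set
IsCore t xs = (i : Fin (length xs)) (j : Fin (lookup xs i)) → ¬ (t ∣ hookLength xs i (toℕ j))

isCore? : ∀ t xs → Dec (IsCore t xs)
isCore? t xs = all? λ i → all? λ j → ¬? (t ∣? hookLength xs i (toℕ j))

-- The partitions of n with at most l parts, all of them at most m.
boxPartitions : (l m n : ℕ) → List (List ℕ)
boxPartitions l       m       zero    = [] ∷ []
boxPartitions zero    m       (suc n) = []
boxPartitions (suc l) zero    (suc n) = []
boxPartitions (suc l) (suc m) (suc n) with m ≤? n
... | yes _ = boxPartitions (suc l) m (suc n) ++ map (suc m ∷_) (boxPartitions l (suc m) (n ∸ m))
... | no  _ = boxPartitions (suc l) m (suc n)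

partitions : ℕ → List (List ℕ)
partitions n = boxPartitions n n n

a : ℕ → ℕ → ℕ
a t n = length (filter (isCore? t) (partitions n))

-- partitions n lists every partition of n exactly once.

private
  link : ∀ {m xs} → All (_≤ m) xs → Linked _≥_ xs → Linked _≥_ (m ∷ xs)
  link []      []  = [-]
  link (p ∷ _) dec = p ∷ dec

  bounded : ∀ {m x xs} → x ≤ m → Linked _≥_ (x ∷ xs) → All (_≤ m) (x ∷ xs)
  bounded p [-]       = p ∷ []
  bounded p (q ∷ dec) = p ∷ bounded (≤-trans q p) dec

  sound : ∀ l m n {xs} → xs ∈ boxPartitions l m n → IsPartition n xs × All (_≤ m) xs
  sound l m zero (here refl) = record { total = refl ; positive = [] ; decreasing = [] } , []
  sound (suc l) (suc m) (suc n) p with m ≤? n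
  ... | no _ with sound (suc l) m (suc n) p
  ...   | isP , bd = isP , All.map m≤n⇒m≤1+n bd
  sound (suc l) (suc m) (suc n) p | yes m≤n with ∈-++⁻ (boxPartitions (suc l) m (suc n)) p
  ... | inj₁ q with sound (suc l) m (suc n) q
  ...   | isP , bd = isP , All.map m≤n⇒m≤1+n bd
  sound (suc l) (suc m) (suc n) p | yes m≤n | inj₂ q with ∈-map⁻ (suc m ∷_) q
  ... | ys , r , refl with sound l (suc m) (n ∸ m) r
  ...   | isP , bd = record
    { total      = cong suc (trans (cong (m +_) (IsPartition.total isP)) (m+[n∸m]≡n m≤n))
    ; positive   = z<s ∷ IsPartition.positive isP
    ; decreasing = link bd (IsPartition.decreasing isP)
    } , ≤-refl ∷ bd

  complete : ∀ l m n {xs} → IsPartition n xs → All (_≤ m) xs → length xs ≤ l →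
             xs ∈ boxPartitions l m n
  complete l m zero {[]} isP bd len = here refl
  complete l m zero {zero ∷ xs} isP bd len with IsPartition.positive isP
  ... | () ∷ _
  complete l m zero {suc x ∷ xs} isP bd len with IsPartition.total isP
  ... | ()
  complete l m (suc n) {[]} isP bd len with IsPartition.total isP
  ... | ()
  complete (suc l) zero (suc n) {x ∷ xs} isP (z≤n ∷ bd) len with IsPartition.positive isP
  ... | () ∷ _
  complete (suc l) (suc m) (suc n) {x ∷ xs} isP (x≤ ∷ bd) (s≤s len) with m ≤? n | x ≟ suc m
  ... | no m≰n | yes refl = ⊥-elim (m≰n (subst (m ≤_) (suc-injective (IsPartition.total isP)) (m≤m+n m (sum xs))))
  ... | no _   | no x≢    = complete (suc l) m (suc n) isP
          (bounded (≤-pred (≤∧≢⇒< x≤ x≢)) (IsPartition.decreasing isP)) (s≤s len)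
  ... | yes _  | no x≢    = ∈-++⁺ˡ (complete (suc l) m (suc n) isP
          (bounded (≤-pred (≤∧≢⇒< x≤ x≢)) (IsPartition.decreasing isP)) (s≤s len))
  ... | yes _  | yes refl = ∈-++⁺ʳ (boxPartitions (suc l) m (suc n)) (∈-map⁺ (suc m ∷_)
          (complete l (suc m) (n ∸ m) record
            { total      = trans (sym (m+n∸m≡n m (sum xs)))
                                 (cong (_∸ m) (suc-injective (IsPartition.total isP)))
            ; positive   = All.tail (IsPartition.positive isP)
            ; decreasing = Linked.tail (IsPartition.decreasing isP)
            } bd len))

  unique : ∀ l m n → Unique (boxPartitions l m n)
  unique l       m       zero    = [] AllPairs.∷ AllPairs.[]
  unique zero    m       (suc n) = AllPairs.[]
  unique (suc l) zero    (suc n) = AllPairs.[]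
  unique (suc l) (suc m) (suc n) with m ≤? n
  ... | no  _ = unique (suc l) m (suc n)
  ... | yes _ = Uniqueₚ.++⁺ (unique (suc l) m (suc n))
                  (Uniqueₚ.map⁺ ∷-injectiveʳ (unique l (suc m) (n ∸ m))) disjoint
    where
    disjoint : ∀ {xs} → ¬ (xs ∈ boxPartitions (suc l) m (suc n) ×
                           xs ∈ map (suc m ∷_) (boxPartitions l (suc m) (n ∸ m)))
    disjoint (p , q) with ∈-map⁻ (suc m ∷_) q
    ... | ys , _ , refl = 1+n≰n (All.head (proj₂ (sound (suc l) m (suc n) p)))

  length≤sum : ∀ {xs} → All (0 <_) xs → length xs ≤ sum xs
  length≤sum []       = z≤n
  length≤sum (p ∷ ps) = +-mono-≤ p (length≤sum ps)

  parts≤sum : ∀ xs → All (_≤ sum xs) xs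
  parts≤sum []       = []
  parts≤sum (x ∷ xs) = m≤m+n x (sum xs) ∷ All.map (λ p → ≤-trans p (m≤n+m (sum xs) x)) (parts≤sum xs)

partitions-sound : ∀ {n xs} → xs ∈ partitions n → IsPartition n xs
partitions-sound {n} p = proj₁ (sound n n n p)

partitions-complete : ∀ {n xs} → IsPartition n xs → xs ∈ partitions n
partitions-complete {n} {xs} isP with IsPartition.total isP
... | refl = complete n n n isP (parts≤sum xs) (length≤sum (IsPartition.positive isP))

partitions-unique : ∀ n → Unique (partitions n)
partitions-unique n = unique n n n

-- With ∸ and / on ℕ, the expressions (x - 5) / 8 that occur as arguments of a 4
-- keep their usual value: x ≥ 5 and the division has no remainder.

private
  9^k : ∀ k → ∃ λ q → 3 ^ (2 * k) ≡ 1 + q * 8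
  9^k zero = 0 , refl
  9^k (suc k) with 9^k k
  ... | q , eq = 1 + 9 * q , trans (cong (3 ^_) (*-suc 2 k)) (trans (cong (λ z → 3 * (3 * z)) eq) (lem q))
    where
    lem : ∀ q → 3 * (3 * (1 + q * 8)) ≡ 1 + (1 + 9 * q) * 8
    lem = solve-∀

  exact : ∀ x q → x ≡ q * 8 + 5 → 8 * ((x ∸ 5) / 8) + 5 ≡ x
  exact x q refl = cong (_+ 5) (begin
    8 * ((q * 8 + 5 ∸ 5) / 8) ≡⟨ cong (λ z → 8 * (z / 8)) (m+n∸n≡m (q * 8) 5) ⟩
    8 * (q * 8 / 8)           ≡⟨ cong (8 *_) (m*n/n≡m q 8) ⟩
    8 * q                     ≡⟨ *-comm 8 q ⟩
    q * 8                     ∎)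
    where open ≡-Reasoning

offset₁-exact : ∀ α i → 1 ≤ α →
  8 * (((8 * i + 15) * 3 ^ (2 * α ∸ 1) ∸ 5) / 8) + 5 ≡ (8 * i + 15) * 3 ^ (2 * α ∸ 1)
offset₁-exact (suc k) i _ with 9^k k
... | q , eq = exact _ (3 * i + 5 + q * (3 * (8 * i + 15))) (trans (cong ((8 * i + 15) *_) pow) (lem i q))
  where
  pow : 3 ^ (2 * suc k ∸ 1) ≡ 3 * (1 + q * 8)
  pow = trans (cong (λ z → 3 ^ (z ∸ 1)) (*-suc 2 k)) (cong (3 *_) eq)
  lem : ∀ i q → (8 * i + 15) * (3 * (1 + q * 8)) ≡ (3 * i + 5 + q * (3 * (8 * i + 15))) * 8 + 5
  lem = solve-∀

offset₂-exact : ∀ β → 8 * ((5 * 3 ^ (2 * β) ∸ 5) / 8) + 5 ≡ 5 * 3 ^ (2 * β)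
offset₂-exact β with 9^k β
... | q , eq = exact _ (5 * q) (trans (cong (5 *_) eq) (lem q))
  where
  lem : ∀ q → 5 * (1 + q * 8) ≡ 5 * q * 8 + 5
  lem = solve-∀

{-# OPTIONS --safe #-}
module Submission where

-- The first-column hook lengths of a 4-core contain no multiple of 4 and are closed
-- under subtracting 4, so a 4-core is given by the numbers (a , b , c) of hook lengths
-- congruent to 1, 2, 3 modulo 4, and every triple occurs; the size is a quadratic
-- polynomial in a, b, c. Conjugation is an involution on the 4-cores of n, so a 4 n has
-- the parity of the number of self-conjugate ones. On triples conjugation is given by
-- three affine formulas, according to the largest hook length, and its fixed points of
-- size n correspond to the odd X, Y > 0 with X² + 4Y² = 8n + 5. As 3 ∣ X² + 4Y² forces
-- 3 ∣ X and 3 ∣ Y, there is no solution when the exponent of 3 in 8n + 5 is odd, and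
-- X = Y = 3^β is the only one when 8n + 5 = 5 · 9^β.

open import Data.Nat using (ℕ; zero; suc; _+_; _*_; _∸_; _^_; _/_; _%_; _≤_; _<_; _≥_; z≤n; s≤s; z<s; _≤?_; _<?_)
open import Data.Nat.Properties
open import Data.Nat.DivMod using (m≡m%n+[m/n]*n; m%n<n; m<n⇒m%n≡m; m*n%n≡0; [m+n]%n≡m%n; [m+kn]%n≡m%n; %-distribˡ-+)
open import Data.Nat.Divisibility using (_∣_; divides)
open import Data.Nat.ListAction using (sum)
open import Data.Nat.Tactic.RingSolver using (solve-∀)
open import Data.Fin using (zero; suc; toℕ; fromℕ<)
open import Data.Fin.Properties using (toℕ<n; toℕ-fromℕ<)
open import Data.List using (List; []; _∷_; _++_; length; filter)
open import Data.List.Properties using (filter-accept; filter-reject)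
open import Data.List.Membership.Propositional using (_∈_; _∉_)
open import Data.List.Membership.Propositional.Properties using (∈-∃++; ∈-filter⁺; ∈-filter⁻)
open import Data.List.Relation.Binary.Permutation.Propositional using (_↭_; ↭-sym; prep; ↭⇒↭ₛ)
open import Data.List.Relation.Binary.Permutation.Propositional.Properties using (shift; ∈-resp-↭; ↭-length)
import Data.List.Relation.Binary.Permutation.Setoid.Properties as ↭ₛ
open import Data.List.Relation.Unary.All as All using (All; []; _∷_)
open import Data.List.Relation.Unary.AllPairs as AllPairs using (AllPairs; []; _∷_)
open import Data.List.Relation.Unary.Any using (here; there)
open import Data.List.Relation.Unary.Linked using (Linked; []; [-]; _∷_)
open import Data.List.Relation.Unary.Linked.Properties using (Linked⇒AllPairs)
open import Data.List.Relation.Unary.Unique.Propositional using (Unique)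
import Data.List.Relation.Unary.Unique.Propositional.Properties as Uniqueₚ
open import Data.Product using (_×_; _,_; proj₂; ∃; ∃₂)
open import Data.Sum as Sum using (_⊎_; inj₁; inj₂)
open import Relation.Binary.Definitions using (tri<; tri≈; tri>)
open import Relation.Binary.PropositionalEquality
open import Relation.Nullary using (¬_; yes; no; contradiction)
open import Defs

-- First-column hook lengths

-- For positive parts the column-0 cell of the row `x` has arm `x ∸ 1` and leg `length xs`, which
-- gives the hook length `x + length xs`.
betas : List ℕ → List ℕ
betas []       = []
betas (x ∷ xs) = x + length xs ∷ betas xs

-- For x ∷ xs weakly decreasing and j < x, the number gap j xs is the first-column hook
-- length of the first row minus the hook length of the cell (0 , j).
gap : ℕ → List ℕ → ℕ
gap j []       = j
gap j (x ∷ xs) with j <? x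
... | yes _ = gap j xs
... | no  _ = suc (gap j xs)

-- Every part counts once on the left: in the filter if it exceeds `j`, in `gap` if not.
length-filter-gap : ∀ j xs → length (filter (j <?_) xs) + gap j xs ≡ j + length xs
length-filter-gap j [] = sym (+-identityʳ j)
length-filter-gap j (x ∷ xs) with j <? x
... | yes j<x rewrite filter-accept (j <?_) {xs = xs} j<x =
  trans (cong suc (length-filter-gap j xs)) (sym (+-suc j (length xs)))
... | no  j≮x rewrite filter-reject (j <?_) {xs = xs} j≮x =
  trans (+-suc _ _) (trans (cong suc (length-filter-gap j xs)) (sym (+-suc j (length xs))))

hookLength-gap : ∀ x xs j → j < x → hookLength (x ∷ xs) zero j + gap j xs ≡ x + length xs
hookLength-gap x xs j j<x = begin
  suc (x ∸ suc j + length (filter (j <?_) xs)) + gap j xs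
    ≡⟨ cong suc (+-assoc (x ∸ suc j) _ _) ⟩
  suc (x ∸ suc j + (length (filter (j <?_) xs) + gap j xs))
    ≡⟨ cong (λ z → suc (x ∸ suc j + z)) (length-filter-gap j xs) ⟩
  suc (x ∸ suc j + (j + length xs))
    ≡⟨ shuffle (x ∸ suc j) j (length xs) ⟩
  x ∸ suc j + suc j + length xs
    ≡⟨ cong (_+ length xs) (m∸n+n≡m j<x) ⟩
  x + length xs ∎
  where
  open ≡-Reasoning
  shuffle : ∀ u j l → suc (u + (j + l)) ≡ u + suc j + l
  shuffle = solve-∀

gap≤ : ∀ j xs → gap j xs ≤ j + length xs
gap≤ j xs = subst (gap j xs ≤_) (length-filter-gap j xs) (m≤n+m (gap j xs) _)

gap-small-parts : ∀ {j xs} → All (_≤ j) xs → gap j xs ≡ j + length xs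
gap-small-parts {j} [] = sym (+-identityʳ j)
gap-small-parts {j} {x ∷ xs} (x≤j ∷ ps) with j <? x
... | yes j<x = contradiction j<x (≤⇒≯ x≤j)
... | no  _   = trans (cong suc (gap-small-parts ps)) (sym (+-suc j (length xs)))

betas< : ∀ {m xs z} → All (_≤ m) xs → z ∈ betas xs → z < m + length xs
betas< {m} {x ∷ xs} (x≤m ∷ ps) (here refl) =
  subst (x + length xs <_) (sym (+-suc m (length xs))) (s≤s (+-monoˡ-≤ (length xs) x≤m))
betas< {m} {x ∷ xs} (x≤m ∷ ps) (there z∈) =
  <-trans (betas< ps z∈) (+-monoʳ-< m (n<1+n (length xs)))

-- As long as parts exceed `j`, the gap stays below their first-column hook lengths. From the first
-- part at most `j` on, it is `j` plus the number of remaining parts, above every remaining element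
-- of `betas`.
gap∉betas : ∀ j {xs} → AllPairs _≥_ xs → gap j xs ∉ betas xs
gap∉betas j {x ∷ xs} (ps ∷ dec) p with j <? x
gap∉betas j {x ∷ xs} (ps ∷ dec) (here eq) | yes j<x =
  <-irrefl eq (≤-<-trans (gap≤ j xs) (+-monoˡ-< (length xs) j<x))
gap∉betas j {x ∷ xs} (ps ∷ dec) (there q) | yes _ = gap∉betas j dec q
gap∉betas j {x ∷ xs} (ps ∷ dec) p | no j≮x = <-irrefl refl (begin-strict
  suc (gap j xs)       ≤⟨ bound p ⟩
  x + length xs        ≤⟨ +-monoˡ-≤ (length xs) x≤j ⟩
  j + length xs        ≡⟨ gap-small-parts (All.map (λ y≤x → ≤-trans y≤x x≤j) ps) ⟨
  gap j xs             <⟨ n<1+n _ ⟩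
  suc (gap j xs)       ∎)
  where
  open ≤-Reasoning
  x≤j : x ≤ j
  x≤j = ≮⇒≥ j≮x
  bound : suc (gap j xs) ∈ x + length xs ∷ betas xs → suc (gap j xs) ≤ x + length xs
  bound (here eq) = ≤-reflexive eq
  bound (there q) = <⇒≤ (betas< ps q)

gap-∷-< : ∀ {j x} xs → j < x → gap j (x ∷ xs) ≡ gap j xs
gap-∷-< {j} {x} xs j<x with j <? x
... | yes _   = refl
... | no  j≮x = contradiction j<x j≮x

gap-∷-≥ : ∀ {j x} xs → x ≤ j → gap j (x ∷ xs) ≡ suc (gap j xs)
gap-∷-≥ {j} {x} xs x≤j with j <? x
... | yes j<x = contradiction j<x (≤⇒≯ x≤j)
... | no  _   = refl

-- Compare `c` with the next element of `betas`: below it the recursion continues; strictly between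
-- two consecutive elements, `c` is the gap of a column `j` with `y ≤ j < x`.
betas-or-gap : ∀ {x xs c} → AllPairs _≥_ (x ∷ xs) → c < x + length xs →
               c ∈ betas xs ⊎ ∃ λ j → j < x × gap j xs ≡ c
betas-or-gap {x} {[]} {c} _ c< = inj₂ (c , subst (c <_) (+-identityʳ x) c< , refl)
betas-or-gap {x} {y ∷ ys} {c} ((y≤x ∷ _) ∷ dec@(ps ∷ _)) c< with <-cmp c (y + length ys)
... | tri≈ _ c≡ _ = inj₁ (here c≡)
... | tri< c<y _ _ with betas-or-gap dec c<y
...   | inj₁ c∈ = inj₁ (there c∈)
...   | inj₂ (j , j<y , eq) = inj₂ (j , ≤-trans j<y y≤x , trans (gap-∷-< ys j<y) eq)
betas-or-gap {x} {y ∷ ys} {c} ((y≤x ∷ _) ∷ dec@(ps ∷ _)) c< | tri> _ _ c> = inj₂ (j , j<x , eq)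
  where
  -- All parts of `y ∷ ys` are at most this `j`, so its gap is `j` plus their number, which is `c`.
  j : ℕ
  j = c ∸ suc (length ys)
  split : j + suc (length ys) ≡ c
  split = m∸n+n≡m (≤-trans (s≤s (m≤n+m (length ys) y)) c>)
  j<x : j < x
  j<x = +-cancelʳ-< (suc (length ys)) j x (subst (_< x + suc (length ys)) (sym split) c<)
  y≤j : y ≤ j
  y≤j = +-cancelʳ-≤ (suc (length ys)) y j (subst₂ _≤_ (sym (+-suc y (length ys))) (sym split) c>)
  eq : gap j (y ∷ ys) ≡ c
  eq = begin
    gap j (y ∷ ys)        ≡⟨ gap-∷-≥ ys y≤j ⟩
    suc (gap j ys)        ≡⟨ cong suc (gap-small-parts (All.map (λ z≤y → ≤-trans z≤y y≤j) ps)) ⟩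
    suc (j + length ys)   ≡⟨ +-suc j (length ys) ⟨
    j + suc (length ys)   ≡⟨ split ⟩
    c                     ∎
    where open ≡-Reasoning

-- Cores in terms of first-column hook lengths

IsCore-tail : ∀ {t x xs} → IsCore t (x ∷ xs) → IsCore t xs
IsCore-tail core i = core (suc i)

-- Otherwise `z` is the gap of some column `j`, and the cell `(0 , j)` has hook length exactly `t`.
IsCore⇒∈betas : ∀ {t x xs z} → AllPairs _≥_ (x ∷ xs) → IsCore t (x ∷ xs) → 0 < t →
                z + t ≡ x + length xs → z ∈ betas xs
IsCore⇒∈betas {t} {x} {xs} {z} dec core 0<t eq
  with betas-or-gap dec (subst (z <_) eq (m<m+n z 0<t))
... | inj₁ z∈ = z∈
... | inj₂ (j , j<x , gap≡z) = contradiction (divides 1 hook≡t) hook∤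
  where
  hook∤ : ¬ (t ∣ hookLength (x ∷ xs) zero j)
  hook∤ = subst (λ k → ¬ (t ∣ hookLength (x ∷ xs) zero k)) (toℕ-fromℕ< j<x) (core zero (fromℕ< j<x))
  hook≡t : hookLength (x ∷ xs) zero j ≡ 1 * t
  hook≡t = +-cancelʳ-≡ z _ _ (begin
    hookLength (x ∷ xs) zero j + z         ≡⟨ cong (hookLength (x ∷ xs) zero j +_) gap≡z ⟨
    hookLength (x ∷ xs) zero j + gap j xs  ≡⟨ hookLength-gap x xs j j<x ⟩
    x + length xs                          ≡⟨ eq ⟨
    z + t                                  ≡⟨ +-comm z t ⟩
    t + z                                  ≡⟨ cong (_+ z) (*-identityˡ t) ⟨
    1 * t + z                              ∎)
    where open ≡-Reasoning

-- A cell of the first row with hook length `suc k * t` would have its gap in `betas xs`, against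
-- `gap∉betas`.
∈betas⇒IsCore : ∀ {t x xs} → AllPairs _≥_ xs → IsCore t xs →
                (∀ z k → z + suc k * t ≡ x + length xs → z ∈ betas xs) → IsCore t (x ∷ xs)
∈betas⇒IsCore dec core closed (suc i) = core i
∈betas⇒IsCore {t} {x} {xs} dec core closed zero j (divides (suc k) eq) =
  gap∉betas (toℕ j) dec (closed (gap (toℕ j) xs) k
    (trans (+-comm (gap (toℕ j) xs) (suc k * t))
      (trans (cong (_+ gap (toℕ j) xs) (sym eq)) (hookLength-gap x xs (toℕ j) (toℕ<n j)))))

-- The abacus of a 4-core

-- (a , b , c) stands for the set of first-column hook lengths consisting of the first
-- a, b, c elements of 1, 5, 9, … and 2, 6, 10, … and 3, 7, 11, … respectively.
State : Set
State = ℕ × ℕ × ℕ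

-- Runner 0 stays empty: repeatedly subtracting 4 from a bead on it would reach 0, which is no
-- first-column hook length. The catch-all clause also covers indices from 4 on, which `Bead` rules
-- out.
height : State → ℕ → ℕ
height (a , b , c) 1 = a
height (a , b , c) 2 = b
height (a , b , c) 3 = c
height (a , b , c) _ = 0

Bead : State → ℕ → Set
Bead t z = ∃₂ λ i r → r < 4 × i < height t r × z ≡ 4 * i + r

-- Adding a bead on a runner where it becomes the largest of all.
data Push : ℕ → State → State → Set where
  push₁ : ∀ {a b c} → b ≤ a → c ≤ a → Push 1 (a , b , c) (suc a , b , c)
  push₂ : ∀ {a b c} → a ≤ suc b → c ≤ b → Push 2 (a , b , c) (a , suc b , c)
  push₃ : ∀ {a b c} → a ≤ suc c → b ≤ suc c → Push 3 (a , b , c) (a , b , suc c)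

-- Beads are added in increasing order. The equation identifies the first-column hook length of the
-- new part with the lowest free position of runner `r`.
data Abacus : State → List ℕ → Set where
  empty : Abacus (0 , 0 , 0) []
  push  : ∀ {t t′ r x xs} → Push r t t′ → Abacus t xs → x + length xs ≡ 4 * height t r + r →
          Abacus t′ (x ∷ xs)

4*i+r%4 : ∀ i {r} → r < 4 → (4 * i + r) % 4 ≡ r
4*i+r%4 i {r} r<4 = begin
  (4 * i + r) % 4  ≡⟨ cong (_% 4) (trans (+-comm (4 * i) r) (cong (r +_) (*-comm 4 i))) ⟩
  (r + i * 4) % 4  ≡⟨ [m+kn]%n≡m%n r i 4 ⟩
  r % 4            ≡⟨ m<n⇒m%n≡m r<4 ⟩
  r                ∎
  where open ≡-Reasoning

4*i+r-injective : ∀ {i j r s} → r < 4 → s < 4 → 4 * i + r ≡ 4 * j + s → i ≡ j × r ≡ s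
4*i+r-injective {i} {j} {r} {s} r<4 s<4 eq = *-cancelˡ-≡ i j 4 (+-cancelʳ-≡ r _ _ (trans eq (cong (4 * j +_) (sym r≡s)))) , r≡s
  where
  r≡s : r ≡ s
  r≡s = trans (sym (4*i+r%4 i r<4)) (trans (cong (_% 4) eq) (4*i+r%4 j s<4))

4*i+r<4*k+s : ∀ {i k r} s → r < 4 → i < k → 4 * i + r < 4 * k + s
4*i+r<4*k+s {i} {k} {r} s r<4 i<k = begin-strict
  4 * i + r   <⟨ +-monoʳ-< (4 * i) r<4 ⟩
  4 * i + 4   ≡⟨ trans (+-comm (4 * i) 4) (sym (*-suc 4 i)) ⟩
  4 * suc i   ≤⟨ *-monoʳ-≤ 4 i<k ⟩
  4 * k       ≤⟨ m≤m+n (4 * k) s ⟩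
  4 * k + s   ∎
  where open ≤-Reasoning

4*i+r<4*k+s′ : ∀ {i k r s} → r < s → i ≤ k → 4 * i + r < 4 * k + s
4*i+r<4*k+s′ r<s i≤k = +-mono-≤-< (*-monoʳ-≤ 4 i≤k) r<s

4*i+r<4*k+s⇒i<k : ∀ {i k r s} → s ≤ r → 4 * i + r < 4 * k + s → i < k
4*i+r<4*k+s⇒i<k {i} {k} s≤r lt =
  ≰⇒> λ k≤i → <⇒≱ lt (+-mono-≤ (*-monoʳ-≤ 4 k≤i) s≤r)

4*i+r<4*k+s⇒i≤k : ∀ {i k r s} → s < 4 → 4 * i + r < 4 * k + s → i ≤ k
4*i+r<4*k+s⇒i≤k {r = r} s<4 lt = ≮⇒≥ λ k<i → <-asym lt (4*i+r<4*k+s r s<4 k<i)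

all-below⇒≤ : ∀ {k r s} m → s ≤ r → (∀ {j} → j < m → 4 * j + r < 4 * k + s) → m ≤ k
all-below⇒≤ zero    s≤r below = z≤n
all-below⇒≤ (suc m) s≤r below = 4*i+r<4*k+s⇒i<k s≤r (below ≤-refl)

all-below⇒≤suc : ∀ {k r s} m → s < 4 → (∀ {j} → j < m → 4 * j + r < 4 * k + s) → m ≤ suc k
all-below⇒≤suc         zero    s<4 below = z≤n
all-below⇒≤suc {r = r} (suc m) s<4 below = s≤s (4*i+r<4*k+s⇒i≤k {r = r} s<4 (below ≤-refl))

Push-runner : ∀ {r t t′} → Push r t t′ → r < 4
Push-runner (push₁ _ _) = s≤s (s≤s z≤n)
Push-runner (push₂ _ _) = s≤s (s≤s (s≤s z≤n))
Push-runner (push₃ _ _) = s≤s (s≤s (s≤s (s≤s z≤n)))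

Push-height-new : ∀ {r t t′} → Push r t t′ → height t′ r ≡ suc (height t r)
Push-height-new (push₁ _ _) = refl
Push-height-new (push₂ _ _) = refl
Push-height-new (push₃ _ _) = refl

Push-height-mono : ∀ {r t t′} → Push r t t′ → ∀ s → height t s ≤ height t′ s
Push-height-mono (push₁ _ _) 0 = z≤n
Push-height-mono (push₁ _ _) 1 = n≤1+n _
Push-height-mono (push₁ _ _) 2 = ≤-refl
Push-height-mono (push₁ _ _) 3 = ≤-refl
Push-height-mono (push₁ _ _) (suc (suc (suc (suc _)))) = z≤n
Push-height-mono (push₂ _ _) 0 = z≤n
Push-height-mono (push₂ _ _) 1 = ≤-refl
Push-height-mono (push₂ _ _) 2 = n≤1+n _
Push-height-mono (push₂ _ _) 3 = ≤-refl
Push-height-mono (push₂ _ _) (suc (suc (suc (suc _)))) = z≤n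
Push-height-mono (push₃ _ _) 0 = z≤n
Push-height-mono (push₃ _ _) 1 = ≤-refl
Push-height-mono (push₃ _ _) 2 = ≤-refl
Push-height-mono (push₃ _ _) 3 = n≤1+n _
Push-height-mono (push₃ _ _) (suc (suc (suc (suc _)))) = z≤n

<suc⇒<⊎≡ : ∀ {i k} → i < suc k → i < k ⊎ i ≡ k
<suc⇒<⊎≡ (s≤s i≤k) = m≤n⇒m<n∨m≡n i≤k

Push-height-split : ∀ {r t t′} → Push r t t′ → ∀ s {i} → i < height t′ s →
                    i < height t s ⊎ (s ≡ r × i ≡ height t r)
Push-height-split (push₁ _ _) 1 lt = Sum.map₂ (refl ,_) (<suc⇒<⊎≡ lt)
Push-height-split (push₁ _ _) 2 lt = inj₁ lt
Push-height-split (push₁ _ _) 3 lt = inj₁ lt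
Push-height-split (push₂ _ _) 1 lt = inj₁ lt
Push-height-split (push₂ _ _) 2 lt = Sum.map₂ (refl ,_) (<suc⇒<⊎≡ lt)
Push-height-split (push₂ _ _) 3 lt = inj₁ lt
Push-height-split (push₃ _ _) 1 lt = inj₁ lt
Push-height-split (push₃ _ _) 2 lt = inj₁ lt
Push-height-split (push₃ _ _) 3 lt = Sum.map₂ (refl ,_) (<suc⇒<⊎≡ lt)

-- The side conditions of `Push` encode this: a runner `s` may stand one higher than the receiving
-- runner `r` exactly if `s < r`.
Push-maximal : ∀ {r t t′} → Push r t t′ → ∀ s {i} → i < height t s →
               4 * i + s < 4 * height t r + r
Push-maximal (push₁ p q) 1 lt = 4*i+r<4*k+s 1 (s≤s (s≤s z≤n)) lt
Push-maximal (push₁ p q) 2 lt = 4*i+r<4*k+s 1 (s≤s (s≤s (s≤s z≤n))) (≤-trans lt p)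
Push-maximal (push₁ p q) 3 lt = 4*i+r<4*k+s 1 ≤-refl (≤-trans lt q)
Push-maximal (push₂ p q) 1 lt = 4*i+r<4*k+s′ ≤-refl (≤-pred (≤-trans lt p))
Push-maximal (push₂ p q) 2 lt = 4*i+r<4*k+s 2 (s≤s (s≤s (s≤s z≤n))) lt
Push-maximal (push₂ p q) 3 lt = 4*i+r<4*k+s 2 ≤-refl (≤-trans lt q)
Push-maximal (push₃ p q) 1 lt = 4*i+r<4*k+s′ (s≤s (s≤s z≤n)) (≤-pred (≤-trans lt p))
Push-maximal (push₃ p q) 2 lt = 4*i+r<4*k+s′ ≤-refl (≤-pred (≤-trans lt q))
Push-maximal (push₃ p q) 3 lt = 4*i+r<4*k+s 3 ≤-refl lt

total : State → ℕ
total (a , b , c) = a + b + c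

Push-total : ∀ {r t t′} → Push r t t′ → total t′ ≡ suc (total t)
Push-total (push₁ _ _) = refl
Push-total (push₂ {a} {b} {c} _ _) = cong (_+ c) (+-suc a b)
Push-total (push₃ {a} {b} {c} _ _) = +-suc (a + b) c

-- The new part is the new bead minus the number of earlier beads, so this bound makes it positive.
Push-total< : ∀ {r t t′} → Push r t t′ → total t < 4 * height t r + r
Push-total< (push₁ {a} p q) = ≤-<-trans (+-mono-≤ (+-monoʳ-≤ a p) q)
  (subst (a + a + a <_) (lemma a) (s≤s (m≤m+n _ a)))
  where
  lemma : ∀ a → suc (a + a + a + a) ≡ 4 * a + 1
  lemma = solve-∀
Push-total< (push₂ {b = b} p q) = ≤-<-trans (+-mono-≤ (+-monoˡ-≤ b p) q)
  (subst (suc b + b + b <_) (lemma b) (s≤s (m≤m+n _ b)))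
  where
  lemma : ∀ a → suc (suc a + a + a + a) ≡ 4 * a + 2
  lemma = solve-∀
Push-total< (push₃ {c = c} p q) = ≤-<-trans (+-monoˡ-≤ c (+-mono-≤ p q))
  (subst (suc c + suc c + c <_) (lemma c) (s≤s (m≤m+n _ c)))
  where
  lemma : ∀ a → suc (suc a + suc a + a + a) ≡ 4 * a + 3
  lemma = solve-∀

Push-functional : ∀ {r t t′ t″} → Push r t t′ → Push r t t″ → t′ ≡ t″
Push-functional (push₁ _ _) (push₁ _ _) = refl
Push-functional (push₂ _ _) (push₂ _ _) = refl
Push-functional (push₃ _ _) (push₃ _ _) = refl

-- The last bead pushed is the largest one, so the state determines it. In the mixed cases the side
-- conditions clash.
Push-injective : ∀ {r s t t′ t″} → Push r t t″ → Push s t′ t″ → r ≡ s × t ≡ t′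
Push-injective (push₁ _ _) (push₁ _ _) = refl , refl
Push-injective (push₂ _ _) (push₂ _ _) = refl , refl
Push-injective (push₃ _ _) (push₃ _ _) = refl , refl
Push-injective (push₁ p q) (push₂ p′ q′) = contradiction p (≤⇒≯ (≤-pred p′))
Push-injective (push₁ p q) (push₃ p′ q′) = contradiction q (≤⇒≯ (≤-pred p′))
Push-injective (push₂ p q) (push₁ p′ q′) = contradiction p′ (≤⇒≯ (≤-pred p))
Push-injective (push₂ p q) (push₃ p′ q′) = contradiction q (≤⇒≯ (≤-pred q′))
Push-injective (push₃ p q) (push₁ p′ q′) = contradiction q′ (≤⇒≯ (≤-pred p))
Push-injective (push₃ p q) (push₂ p′ q′) = contradiction q′ (≤⇒≯ (≤-pred q))

Abacus-length : ∀ {t xs} → Abacus t xs → length xs ≡ total t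
Abacus-length empty = refl
Abacus-length (push p ab _) = trans (cong suc (Abacus-length ab)) (sym (Push-total p))

∈betas⇒Bead : ∀ {t xs z} → Abacus t xs → z ∈ betas xs → Bead t z
∈betas⇒Bead {z = z} (push {t} {r = r} p ab eq) (here z≡) =
  height t r , r , Push-runner p , ≤-reflexive (sym (Push-height-new p)) , trans z≡ eq
∈betas⇒Bead (push p ab eq) (there z∈) with ∈betas⇒Bead ab z∈
... | i , s , s<4 , i< , z≡ = i , s , s<4 , ≤-trans i< (Push-height-mono p s) , z≡

Bead⇒∈betas : ∀ {t xs z} → Abacus t xs → Bead t z → z ∈ betas xs
Bead⇒∈betas empty (i , 0 , _ , () , _)
Bead⇒∈betas empty (i , 1 , _ , () , _)
Bead⇒∈betas empty (i , 2 , _ , () , _)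
Bead⇒∈betas empty (i , 3 , _ , () , _)
Bead⇒∈betas empty (i , suc (suc (suc (suc _))) , _ , () , _)
Bead⇒∈betas (push p ab eq) (i , s , s<4 , i< , z≡) with Push-height-split p s i<
... | inj₁ i<′           = there (Bead⇒∈betas ab (i , s , s<4 , i<′ , z≡))
... | inj₂ (refl , refl) = here (trans z≡ (sym eq))

betas<new : ∀ {r t t′ xs z} → Push r t t′ → Abacus t xs → z ∈ betas xs → z < 4 * height t r + r
betas<new p ab z∈ with ∈betas⇒Bead ab z∈
... | i , s , s<4 , i< , refl = Push-maximal p s i<

Abacus-decreasing : ∀ {t xs} → Abacus t xs → Linked _≥_ xs
Abacus-decreasing empty = []
Abacus-decreasing (push {xs = []} _ _ _) = [-]
Abacus-decreasing (push {x = x} {xs = y ∷ ys} p ab eq) = y≤x ∷ Abacus-decreasing ab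
  where
  y≤x : y ≤ x
  y≤x = +-cancelʳ-≤ (suc (length ys)) y x (subst₂ _≤_ (sym (+-suc y (length ys))) (sym eq)
    (betas<new p ab (here refl)))

Abacus-positive : ∀ {t xs} → Abacus t xs → All (0 <_) xs
Abacus-positive empty = []
Abacus-positive (push {x = x} {xs = xs} p ab eq) =
  +-cancelʳ-< (length xs) 0 x (subst₂ _<_ (sym (Abacus-length ab)) (sym eq) (Push-total< p))
  ∷ Abacus-positive ab

-- Subtracting a positive multiple of 4 from the new bead leads to a lower position on the same
-- runner, and those are all filled.
Abacus-core : ∀ {t xs} → Abacus t xs → IsCore 4 xs
Abacus-core empty ()
Abacus-core (push {t} {r = r} {x = x} {xs = xs} p ab eq) =
  ∈betas⇒IsCore (Linked⇒AllPairs (λ y≤x z≤y → ≤-trans z≤y y≤x) (Abacus-decreasing ab)) (Abacus-core ab) closed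
  where
  closed : ∀ z k → z + suc k * 4 ≡ x + length xs → z ∈ betas xs
  closed z k eq′ = Bead⇒∈betas ab (i , r , Push-runner p , i< , z≡)
    where
    i : ℕ
    i = height t r ∸ suc k
    z+ : z + suc k * 4 ≡ 4 * height t r + r
    z+ = trans eq′ eq
    k<h : suc k ≤ height t r
    k<h = ≮⇒≥ λ h≤k → <⇒≱ (subst (_< 4 * suc k + 0) (sym z+) (4*i+r<4*k+s 0 (Push-runner p) h≤k))
      (≤-trans (≤-reflexive (trans (+-identityʳ _) (*-comm 4 (suc k)))) (m≤n+m _ z))
    i< : i < height t r
    i< = ∸-monoʳ-< z<s k<h
    z≡ : z ≡ 4 * i + r
    z≡ = +-cancelʳ-≡ (suc k * 4) _ _ (begin
      z + suc k * 4              ≡⟨ z+ ⟩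
      4 * height t r + r         ≡⟨ cong (λ h → 4 * h + r) (m∸n+n≡m k<h) ⟨
      4 * (i + suc k) + r        ≡⟨ shuffle i (suc k) r ⟩
      4 * i + r + suc k * 4      ∎)
      where
      open ≡-Reasoning
      shuffle : ∀ i k r → 4 * (i + k) + r ≡ 4 * i + r + k * 4
      shuffle = solve-∀

Abacus-unique-list : ∀ {t xs ys} → Abacus t xs → Abacus t ys → xs ≡ ys
Abacus-unique-list empty empty = refl
Abacus-unique-list (push p ab eq) (push q ab′ eq′) with Push-injective p q
... | refl , refl with Abacus-unique-list ab ab′
...   | refl = cong (_∷ _) (+-cancelʳ-≡ _ _ _ (trans eq (sym eq′)))

Abacus-unique-state : ∀ {t t′ xs} → Abacus t xs → Abacus t′ xs → t ≡ t′
Abacus-unique-state empty empty = refl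
Abacus-unique-state (push {t} {r = r} p ab eq) (push {r = s} q ab′ eq′)
  with Abacus-unique-state ab ab′
... | refl with 4*i+r-injective {height t r} {height t s} (Push-runner p) (Push-runner q) (trans (sym eq) eq′)
...   | _ , refl = Push-functional p q

-- The triple of a given 4-core

div-mod-4 : ∀ n → ∃₂ λ i r → r < 4 × n ≡ 4 * i + r
div-mod-4 n = n / 4 , n % 4 , m%n<n n 4 ,
  trans (m≡m%n+[m/n]*n n 4) (trans (+-comm (n % 4) _) (cong (_+ n % 4) (*-comm (n / 4) 4)))

-- Write the new first-column hook length as `4 * i + r`. It exceeds all earlier beads, so `i` is at
-- least the height of runner `r`; if `i > 0`, the core condition makes `4 * (i ∸ 1) + r` a bead, so
-- `i` is at most that height.
core⇒Abacus : ∀ {xs} → AllPairs _≥_ xs → All (0 <_) xs → IsCore 4 xs → ∃ λ t → Abacus t xs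
core⇒Abacus [] _ _ = (0 , 0 , 0) , empty
core⇒Abacus {x ∷ xs} dec@(x≥ ∷ dec′) (0<x ∷ pos) core
  with core⇒Abacus dec′ pos (IsCore-tail {4} {x} core) | div-mod-4 (x + length xs)
... | t , ab | i , r , r<4 , eq = result t r r<4 ab eq i≡h below
  where
  below : ∀ s {j} → s < 4 → j < height t s → 4 * j + s < 4 * i + r
  below s {j} s<4 lt = subst (4 * j + s <_) eq (betas< x≥ (Bead⇒∈betas ab (_ , s , s<4 , lt , refl)))
  i≤h : ∀ i → x + length xs ≡ 4 * i + r → i ≤ height t r
  i≤h zero    _   = z≤n
  i≤h (suc i) eq′ with ∈betas⇒Bead ab
    (IsCore⇒∈betas {z = 4 * i + r} dec core z<s (trans (shuffle i r) (sym eq′)))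
    where
    shuffle : ∀ i r → 4 * i + r + 4 ≡ 4 * suc i + r
    shuffle = solve-∀
  ... | j , s , s<4 , j< , eq″ with 4*i+r-injective {i} {j} r<4 s<4 eq″
  ...   | refl , refl = j<
  i≡h : i ≡ height t r
  i≡h = ≤-antisym (i≤h i eq) (≮⇒≥ λ i<h → <-irrefl refl (below r r<4 i<h))
  result : ∀ t r → r < 4 → Abacus t xs → x + length xs ≡ 4 * i + r → i ≡ height t r →
           (∀ s {j} → s < 4 → j < height t s → 4 * j + s < 4 * i + r) →
           ∃ λ t′ → Abacus t′ (x ∷ xs)
  -- Runner 0 has height 0, so the new hook length would be 0 although the part is positive.
  result t 0 _ _ eq refl _ = contradiction 0<x (<-irrefl (sym (m+n≡0⇒m≡0 x eq)))
  result (a , b , c) 1 _ ab eq refl below =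
    _ , push (push₁ (all-below⇒≤ b (s≤s z≤n) (below 2 (s≤s (s≤s (s≤s z≤n)))))
                    (all-below⇒≤ c (s≤s z≤n) (below 3 ≤-refl))) ab eq
  result (a , b , c) 2 _ ab eq refl below =
    _ , push (push₂ (all-below⇒≤suc a (s≤s (s≤s (s≤s z≤n))) (below 1 (s≤s (s≤s z≤n))))
                    (all-below⇒≤ c (s≤s (s≤s z≤n)) (below 3 ≤-refl))) ab eq
  result (a , b , c) 3 _ ab eq refl below =
    _ , push (push₃ (all-below⇒≤suc a ≤-refl (below 1 (s≤s (s≤s z≤n))))
                    (all-below⇒≤suc b ≤-refl (below 2 (s≤s (s≤s (s≤s z≤n)))))) ab eq
  result t (suc (suc (suc (suc r)))) (s≤s (s≤s (s≤s (s≤s ())))) _ _ _ _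

-- Tells which of `4 * a + 1`, `4 * b + 2`, `4 * c + 3` is the largest; equal coordinates are
-- decided by the larger residue.
data Top : State → Set where
  top₁ : ∀ {a b c} → b < a → c < a → Top (a , b , c)
  top₂ : ∀ {a b c} → a ≤ b → c < b → Top (a , b , c)
  top₃ : ∀ {a b c} → a ≤ c → b ≤ c → Top (a , b , c)

top : ∀ t → Top t
top (a , b , c) with a ≤? c | b ≤? c | a ≤? b
... | yes a≤c | yes b≤c | _       = top₃ a≤c b≤c
... | _       | no  b≰c | yes a≤b = top₂ a≤b (≰⇒> b≰c)
... | no  a≰c | _       | no  a≰b = top₁ (≰⇒> a≰b) (≰⇒> a≰c)
... | no  a≰c | yes b≤c | yes a≤b = contradiction (≤-trans a≤b b≤c) a≰c
... | yes a≤c | no  b≰c | no  a≰b = contradiction (≤-trans (<⇒≤ (≰⇒> a≰b)) a≤c) b≰c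

pop : ∀ t → t ≡ (0 , 0 , 0) ⊎ ∃₂ λ r t′ → Push r t′ t
pop t@(a , b , c) with top t
pop (zero  , b     , c)     | top₁ () _
pop (suc a , b     , c)     | top₁ (s≤s b≤a) (s≤s c≤a) = inj₂ (1 , (a , b , c) , push₁ b≤a c≤a)
pop (a     , zero  , c)     | top₂ _ ()
pop (a     , suc b , c)     | top₂ a≤b (s≤s c≤b) = inj₂ (2 , (a , b , c) , push₂ a≤b c≤b)
pop (zero  , zero  , zero)  | top₃ z≤n z≤n = inj₁ refl
pop (a     , b     , suc c) | top₃ a≤c b≤c = inj₂ (3 , (a , b , c) , push₃ a≤c b≤c)

Abacus-exists : ∀ t → ∃ (Abacus t)
Abacus-exists t = go (total t) t refl
  where
  go : ∀ n t → total t ≡ n → ∃ (Abacus t)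
  go n t eq with pop t
  ... | inj₁ refl = [] , empty
  go zero    t eq | inj₂ (r , t′ , p) with trans (sym (Push-total p)) eq
  ... | ()
  go (suc n) t eq | inj₂ (r , t′ , p) with go n t′ (suc-injective (trans (sym (Push-total p)) eq))
  -- The new part is the pushed bead minus the number of beads before it; `Push-total<` makes this
  -- subtraction exact.
  ... | xs , ab = _ , push p ab (m∸n+n≡m (≤-trans (≤-reflexive (Abacus-length ab)) (<⇒≤ (Push-total< p))))

-- The size of a 4-core

-- With `k = a + b + c`, twice the sum of the beads minus `k * (k ∸ 1)` is twice the size of the
-- core. Its positive and negative terms are kept apart to stay in the natural numbers.
posPart negPart : State → ℕ
posPart (a , b , c) = 3 * (a * a + b * b + c * c) + b + 3 * c
negPart (a , b , c) = 2 * (a * b + b * c + c * a) + a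

Weight : State → ℕ → Set
Weight t n = 2 * n + negPart t ≡ posPart t

Weight-unique : ∀ t {m n} → Weight t m → Weight t n → m ≡ n
Weight-unique t {m} {n} w w′ = *-cancelˡ-≡ m n 2 (+-cancelʳ-≡ (negPart t) _ _ (trans w (sym w′)))

Push-Weight : ∀ {r t t′ x n} → Push r t t′ → x + total t ≡ 4 * height t r + r → Weight t n → Weight t′ (x + n)
-- Adding `2 * total t` on both sides turns the part `x` into the bead `x + total t`.
Push-Weight {t = t} {t′} {x} {n} p eq w = +-cancelʳ-≡ (2 * total t) _ _ (begin
  2 * (x + n) + negPart t′ + 2 * total t
    ≡⟨ shuffle x n (negPart t′) (total t) ⟩
  2 * n + negPart t′ + 2 * (x + total t)
    ≡⟨ step p eq w ⟩
  posPart t′ + 2 * total t ∎)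
  where
  open ≡-Reasoning
  shuffle : ∀ x n N s → 2 * (x + n) + N + 2 * s ≡ 2 * n + N + 2 * (x + s)
  shuffle = solve-∀
  step : ∀ {r t t′} → Push r t t′ → x + total t ≡ 4 * height t r + r → Weight t n →
         2 * n + negPart t′ + 2 * (x + total t) ≡ posPart t′ + 2 * total t
  -- In each case the term added to `w` is the growth of `negPart` plus twice the new bead.
  step (push₁ {a} {b} {c} _ _) eq w = trans (cong (λ e → 2 * n + negPart (suc a , b , c) + 2 * e) eq)
    (trans (before n a b c) (trans (cong (_+ (2 * b + 2 * c + 1 + 8 * a + 2)) w) (after a b c)))
    where
    before : ∀ n a b c → 2 * n + (2 * (suc a * b + b * c + c * suc a) + suc a) + 2 * (4 * a + 1) ≡
             2 * n + (2 * (a * b + b * c + c * a) + a) + (2 * b + 2 * c + 1 + 8 * a + 2)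
    before = solve-∀
    after : ∀ a b c → 3 * (a * a + b * b + c * c) + b + 3 * c + (2 * b + 2 * c + 1 + 8 * a + 2) ≡
            3 * (suc a * suc a + b * b + c * c) + b + 3 * c + 2 * (a + b + c)
    after = solve-∀
  step (push₂ {a} {b} {c} _ _) eq w = trans (cong (λ e → 2 * n + negPart (a , suc b , c) + 2 * e) eq)
    (trans (before n a b c) (trans (cong (_+ (2 * a + 2 * c + 8 * b + 4)) w) (after a b c)))
    where
    before : ∀ n a b c → 2 * n + (2 * (a * suc b + suc b * c + c * a) + a) + 2 * (4 * b + 2) ≡
             2 * n + (2 * (a * b + b * c + c * a) + a) + (2 * a + 2 * c + 8 * b + 4)
    before = solve-∀
    after : ∀ a b c → 3 * (a * a + b * b + c * c) + b + 3 * c + (2 * a + 2 * c + 8 * b + 4) ≡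
            3 * (a * a + suc b * suc b + c * c) + suc b + 3 * c + 2 * (a + b + c)
    after = solve-∀
  step (push₃ {a} {b} {c} _ _) eq w = trans (cong (λ e → 2 * n + negPart (a , b , suc c) + 2 * e) eq)
    (trans (before n a b c) (trans (cong (_+ (2 * a + 2 * b + 8 * c + 6)) w) (after a b c)))
    where
    before : ∀ n a b c → 2 * n + (2 * (a * b + b * suc c + suc c * a) + a) + 2 * (4 * c + 3) ≡
             2 * n + (2 * (a * b + b * c + c * a) + a) + (2 * a + 2 * b + 8 * c + 6)
    before = solve-∀
    after : ∀ a b c → 3 * (a * a + b * b + c * c) + b + 3 * c + (2 * a + 2 * b + 8 * c + 6) ≡
            3 * (a * a + b * b + suc c * suc c) + b + 3 * suc c + 2 * (a + b + c)
    after = solve-∀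

Abacus-Weight : ∀ {t xs} → Abacus t xs → Weight t (sum xs)
Abacus-Weight empty = refl
Abacus-Weight (push {x = x} p ab eq) =
  Push-Weight {x = x} p (trans (cong (x +_) (sym (Abacus-length ab))) eq) (Abacus-Weight ab)

-- Conjugation

-- Conjugating a core reflects the set {0, 4a + 1, 4b + 2, 4c + 3} of first empty positions
-- by z ↦ max − z; the constructors correspond to the runner on which the maximum lies.
data Conj : State → State → Set where
  conj₁ : ∀ {a b c b′ c′} → c + suc b′ ≡ a → b + suc c′ ≡ a → Conj (a , b , c) (a , b′ , c′)
  conj₂ : ∀ {a b c a′ c′} → a + a′ ≡ b → c + suc c′ ≡ b → Conj (a , b , c) (a′ , b , c′)
  conj₃ : ∀ {a b c a′ b′} → b + a′ ≡ c → a + b′ ≡ c → Conj (a , b , c) (a′ , b′ , c)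

Conj-exists : ∀ t → ∃ (Conj t)
Conj-exists t@(a , b , c) with top t
... | top₁ b<a c<a = _ , conj₁ (m+1+[n∸1+m]≡n c<a) (m+1+[n∸1+m]≡n b<a)
  where
  m+1+[n∸1+m]≡n : ∀ {m n} → m < n → m + suc (n ∸ suc m) ≡ n
  m+1+[n∸1+m]≡n {m} m<n = trans (+-suc m _) (m+[n∸m]≡n m<n)
... | top₂ a≤b c<b = _ , conj₂ (m+[n∸m]≡n a≤b) (trans (+-suc c _) (m+[n∸m]≡n c<b))
... | top₃ a≤c b≤c = _ , conj₃ (m+[n∸m]≡n b≤c) (m+[n∸m]≡n a≤c)

swap-suc : ∀ m n {k} → m + suc n ≡ k → n + suc m ≡ k
swap-suc m n eq = trans (trans (+-suc n m) (trans (cong suc (+-comm n m)) (sym (+-suc m n)))) eq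

swap : ∀ m n {k} → m + n ≡ k → n + m ≡ k
swap m n eq = trans (+-comm n m) eq

Conj-sym : ∀ {t t′} → Conj t t′ → Conj t′ t
Conj-sym (conj₁ {b = b} {c} {b′} {c′} p q) = conj₁ (swap-suc b c′ q) (swap-suc c b′ p)
Conj-sym (conj₂ {a} {_} {c} {a′} {c′} p q) = conj₂ (swap a a′ p) (swap-suc c c′ q)
Conj-sym (conj₃ {a} {b} {_} {a′} {b′} p q) = conj₃ (swap a b′ q) (swap b a′ p)

+-cancelˡ : ∀ m {n o k} → m + n ≡ k → m + o ≡ k → n ≡ o
+-cancelˡ m {n} {o} p q = +-cancelˡ-≡ m n o (trans p (sym q))

+suc≡⇒< : ∀ {m n k} → m + suc n ≡ k → m < k
+suc≡⇒< {m} eq = m+n≤o⇒m≤o (suc m) (≤-reflexive (trans (sym (+-suc m _)) eq))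

+≡⇒≤ : ∀ {m n k} → m + n ≡ k → m ≤ k
+≡⇒≤ {m} eq = m+n≤o⇒m≤o m (≤-reflexive eq)

-- Each constructor bounds two coordinates by the third as in `Top`, so no two constructors share a
-- source.
Conj-functional : ∀ {t t′ t″} → Conj t t′ → Conj t t″ → t′ ≡ t″
Conj-functional {t = _ , b , c} (conj₁ p q) (conj₁ p′ q′) = cong₂ (λ y z → _ , y , z)
  (suc-injective (+-cancelˡ c p p′)) (suc-injective (+-cancelˡ b q q′))
Conj-functional {t = a , _ , c} (conj₂ p q) (conj₂ p′ q′) = cong₂ (λ y z → y , _ , z)
  (+-cancelˡ a p p′) (suc-injective (+-cancelˡ c q q′))
Conj-functional {t = a , b , _} (conj₃ p q) (conj₃ p′ q′) = cong₂ (λ y z → y , z , _)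
  (+-cancelˡ b p p′) (+-cancelˡ a q q′)
Conj-functional (conj₁ p q) (conj₂ p′ q′) = contradiction (+≡⇒≤ p′) (<⇒≱ (+suc≡⇒< q))
Conj-functional (conj₁ p q) (conj₃ p′ q′) = contradiction (+≡⇒≤ q′) (<⇒≱ (+suc≡⇒< p))
Conj-functional (conj₂ p q) (conj₁ p′ q′) = contradiction (+≡⇒≤ p) (<⇒≱ (+suc≡⇒< q′))
Conj-functional (conj₂ p q) (conj₃ p′ q′) = contradiction (+≡⇒≤ p′) (<⇒≱ (+suc≡⇒< q))
Conj-functional (conj₃ p q) (conj₁ p′ q′) = contradiction (+≡⇒≤ q) (<⇒≱ (+suc≡⇒< p′))
Conj-functional (conj₃ p q) (conj₂ p′ q′) = contradiction (+≡⇒≤ p) (<⇒≱ (+suc≡⇒< q′))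

-- Names the common difference `d` of two splittings of `k`, so that matching on `refl` can
-- eliminate the dependent coordinates.
∃-complement : ∀ {m n k x y} → m ≤ n → m + x ≡ k → n + y ≡ k → ∃ λ d → m + d ≡ n × x ≡ d + y
∃-complement {m} {n} {k} {x} {y} m≤n p q = n ∸ m , m+[n∸m]≡n m≤n , +-cancelˡ-≡ m _ _ (begin
  m + x             ≡⟨ trans p (sym q) ⟩
  n + y             ≡⟨ cong (_+ y) (m+[n∸m]≡n m≤n) ⟨
  m + (n ∸ m) + y   ≡⟨ +-assoc m (n ∸ m) y ⟩
  m + (n ∸ m + y)   ∎)
  where open ≡-Reasoning

-- Equality of `posPart` minus `negPart` for both states, that is, of twice the sizes.
Balanced : State → State → Set
Balanced t t′ = negPart t + posPart t′ ≡ posPart t + negPart t′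

-- After ordering two of the coordinates, the state and its conjugate are parametrised
-- without subtraction and the claim is a semiring identity.
Conj-balanced : ∀ {t t′} → Conj t t′ → Balanced t t′
Conj-balanced (conj₁ {b = b} {c} {b′} {c′} p q) with ≤-total b c
... | inj₁ b≤c with ∃-complement b≤c q p
...   | d , refl , eq with p | suc-injective (trans eq (+-suc d b′))
...     | refl | refl = identity b d b′
  where
  identity : ∀ b d b′ → let c = b + d ; a = c + suc b′ ; c′ = d + b′ in
             2 * (a * b + b * c + c * a) + a + (3 * (a * a + b′ * b′ + c′ * c′) + b′ + 3 * c′) ≡
               3 * (a * a + b * b + c * c) + b + 3 * c + (2 * (a * b′ + b′ * c′ + c′ * a) + a)
  identity = solve-∀
Conj-balanced (conj₁ {b = b} {c} {b′} {c′} p q) | inj₂ c≤b with ∃-complement c≤b p q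
...   | d , refl , eq with q | suc-injective (trans eq (+-suc d c′))
...     | refl | refl = identity c d c′
  where
  identity : ∀ c d c′ → let b = c + d ; a = b + suc c′ ; b′ = d + c′ in
             2 * (a * b + b * c + c * a) + a + (3 * (a * a + b′ * b′ + c′ * c′) + b′ + 3 * c′) ≡
               3 * (a * a + b * b + c * c) + b + 3 * c + (2 * (a * b′ + b′ * c′ + c′ * a) + a)
  identity = solve-∀
Conj-balanced (conj₂ {a} {b} {c} {a′} {c′} p q) with ≤-<-connex a c
... | inj₁ a≤c with ∃-complement a≤c p q
...   | d , refl , refl with q
...     | refl = identity a d c′
  where
  identity : ∀ a d c′ → let c = a + d ; b = c + suc c′ ; a′ = d + suc c′ in
             2 * (a * b + b * c + c * a) + a + (3 * (a′ * a′ + b * b + c′ * c′) + b + 3 * c′) ≡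
               3 * (a * a + b * b + c * c) + b + 3 * c + (2 * (a′ * b + b * c′ + c′ * a′) + a′)
  identity = solve-∀
Conj-balanced (conj₂ {a} {b} {c} {a′} {c′} p q) | inj₂ c<a
  with ∃-complement {x = c′} c<a (trans (sym (+-suc c c′)) q) p
...   | d , refl , refl with p
...     | refl = identity c d a′
  where
  identity : ∀ c d a′ → let a = suc c + d ; b = a + a′ ; c′ = d + a′ in
             2 * (a * b + b * c + c * a) + a + (3 * (a′ * a′ + b * b + c′ * c′) + b + 3 * c′) ≡
               3 * (a * a + b * b + c * c) + b + 3 * c + (2 * (a′ * b + b * c′ + c′ * a′) + a′)
  identity = solve-∀
Conj-balanced (conj₃ {a} {b} {c} {a′} {b′} p q) with ≤-total a b
... | inj₁ a≤b with ∃-complement a≤b q p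
...   | d , refl , refl with p
...     | refl = identity a d a′
  where
  identity : ∀ a d a′ → let b = a + d ; c = b + a′ ; b′ = d + a′ in
             2 * (a * b + b * c + c * a) + a + (3 * (a′ * a′ + b′ * b′ + c * c) + b′ + 3 * c) ≡
               3 * (a * a + b * b + c * c) + b + 3 * c + (2 * (a′ * b′ + b′ * c + c * a′) + a′)
  identity = solve-∀
Conj-balanced (conj₃ {a} {b} {c} {a′} {b′} p q) | inj₂ b≤a with ∃-complement b≤a p q
...   | d , refl , refl with q
...     | refl = identity b d b′
  where
  identity : ∀ b d b′ → let a = b + d ; c = a + b′ ; a′ = d + b′ in
             2 * (a * b + b * c + c * a) + a + (3 * (a′ * a′ + b′ * b′ + c * c) + b′ + 3 * c) ≡
               3 * (a * a + b * b + c * c) + b + 3 * c + (2 * (a′ * b′ + b′ * c + c * a′) + a′)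
  identity = solve-∀

Conj-Weight : ∀ {t t′ n} → Conj t t′ → Weight t n → Weight t′ n
Conj-Weight {t} {t′} {n} cj w = +-cancelʳ-≡ (negPart t) _ _ (begin
  2 * n + negPart t′ + negPart t    ≡⟨ exchange (2 * n) (negPart t′) (negPart t) ⟩
  2 * n + negPart t + negPart t′    ≡⟨ cong (_+ negPart t′) w ⟩
  posPart t + negPart t′            ≡⟨ Conj-balanced cj ⟨
  negPart t + posPart t′            ≡⟨ +-comm (negPart t) (posPart t′) ⟩
  posPart t′ + negPart t            ∎)
  where
  open ≡-Reasoning
  exchange : ∀ x y z → x + y + z ≡ x + z + y
  exchange = solve-∀

-- Self-conjugate states and sums of two squares

-- `self₁` collects the fixed points of `conj₃` and `self₃` those of `conj₁`; the subscript is the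
-- residue of `X` modulo 4.
data SelfConj : State → ℕ → ℕ → Set where
  self₁ : ∀ {a b X Y} → X ≡ 4 * a + 1 → Y ≡ 2 * b + 1 → SelfConj (a , b , b + a) X Y
  self₃ : ∀ {b c X Y} → X ≡ 4 * c + 3 → Y ≡ 2 * b + 1 → SelfConj (c + suc b , b , c) X Y

Conj⇒SelfConj : ∀ {t} → Conj t t → ∃₂ (SelfConj t)
Conj⇒SelfConj (conj₁ refl _) = _ , _ , self₃ refl refl
-- A fixed point of `conj₂` would give `2 * a = b = 2 * c + 1`.
Conj⇒SelfConj (conj₂ {a} {c = c} p q) = contradiction
  (trans (double a) (trans (trans p (sym q)) (trans (+-suc c c) (cong suc (sym (double c)))))) (even≢odd a c)
  where
  double : ∀ n → 2 * n ≡ n + n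
  double n = cong (n +_) (+-identityʳ n)
Conj⇒SelfConj (conj₃ refl _) = _ , _ , self₁ refl refl

SelfConj⇒Conj : ∀ {t X Y} → SelfConj t X Y → Conj t t
SelfConj⇒Conj (self₁ {a} {b} _ _) = conj₃ refl (+-comm a b)
SelfConj⇒Conj (self₃ {b} {c} _ _) = conj₁ refl (swap-suc c b refl)

-- The residue of `X` modulo 4 selects the constructor; then `X` and `Y` give the two free
-- coordinates.
SelfConj-injective : ∀ {t t′ X Y} → SelfConj t X Y → SelfConj t′ X Y → t ≡ t′
SelfConj-injective (self₁ {a} {b} x y) (self₁ {a′} {b′} x′ y′)
  with *-cancelˡ-≡ a a′ 4 (+-cancelʳ-≡ 1 _ _ (trans (sym x) x′)) | *-cancelˡ-≡ b b′ 2 (+-cancelʳ-≡ 1 _ _ (trans (sym y) y′))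
... | refl | refl = refl
SelfConj-injective (self₃ {b} {c} x y) (self₃ {b′} {c′} x′ y′)
  with *-cancelˡ-≡ c c′ 4 (+-cancelʳ-≡ 3 _ _ (trans (sym x) x′)) | *-cancelˡ-≡ b b′ 2 (+-cancelʳ-≡ 1 _ _ (trans (sym y) y′))
... | refl | refl = refl
SelfConj-injective (self₁ {a} x y) (self₃ {c = c} x′ y′)
  with 4*i+r-injective {a} {c} (s≤s (s≤s z≤n)) ≤-refl (trans (sym x) x′)
... | ()
SelfConj-injective (self₃ {c = c} x y) (self₁ {a} x′ y′)
  with 4*i+r-injective {c} {a} ≤-refl (s≤s (s≤s z≤n)) (trans (sym x) x′)
... | ()

-- On a state of weight `n`, `posPart` minus `negPart` is `2 * n`, so this becomes X² + 4Y² = 8n +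
-- 5.
SelfConj-identity : ∀ {t X Y} → SelfConj t X Y → X * X + 4 * (Y * Y) + 4 * negPart t ≡ 4 * posPart t + 5
SelfConj-identity (self₁ {a} {b} refl refl) = identity a b
  where
  identity : ∀ a b → let X = 4 * a + 1 ; Y = 2 * b + 1 ; c = b + a in
    X * X + 4 * (Y * Y) + 4 * (2 * (a * b + b * c + c * a) + a) ≡
    4 * (3 * (a * a + b * b + c * c) + b + 3 * c) + 5
  identity = solve-∀
SelfConj-identity (self₃ {b} {c} refl refl) = identity b c
  where
  identity : ∀ b c → let X = 4 * c + 3 ; Y = 2 * b + 1 ; a = c + suc b in
    X * X + 4 * (Y * Y) + 4 * (2 * (a * b + b * c + c * a) + a) ≡
    4 * (3 * (a * a + b * b + c * c) + b + 3 * c) + 5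
  identity = solve-∀

4*Weight : ∀ n N → 4 * (2 * n + N) + 5 ≡ 8 * n + 5 + 4 * N
4*Weight = solve-∀

Weight⇒squares : ∀ {t X Y n} → SelfConj t X Y → Weight t n → X * X + 4 * (Y * Y) ≡ 8 * n + 5
Weight⇒squares {t} {n = n} sc w = +-cancelʳ-≡ (4 * negPart t) _ _
  (trans (SelfConj-identity sc) (trans (cong (λ z → 4 * z + 5) (sym w)) (4*Weight n (negPart t))))

squares⇒Weight : ∀ {t X Y n} → SelfConj t X Y → X * X + 4 * (Y * Y) ≡ 8 * n + 5 → Weight t n
squares⇒Weight {t} {n = n} sc eq = *-cancelˡ-≡ _ _ 4 (+-cancelʳ-≡ 5 _ _
  (trans (4*Weight n (negPart t)) (trans (cong (_+ 4 * negPart t) (sym eq)) (SelfConj-identity sc))))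

-- Parity by a pairing

-- The involution enters as a symmetric functional relation; `Closed` provides the partners inside
-- the list.
module Pairing {A : Set} (R : A → A → Set)
  (R-sym : ∀ {x y} → R x y → R y x)
  (R-functional : ∀ {x y z} → R x y → R x z → y ≡ z) where

  Closed : List A → Set
  Closed xs = ∀ {x} → x ∈ xs → ∃ λ y → y ∈ xs × R x y

  extract : ∀ {x : A} {xs} → x ∈ xs → ∃ λ ys → xs ↭ x ∷ ys
  extract {x} x∈xs with ∈-∃++ x∈xs
  ... | ys , zs , refl = ys ++ zs , shift x ys zs

  Unique-↭ : ∀ {xs ys : List A} → xs ↭ ys → Unique xs → Unique ys
  Unique-↭ p = ↭ₛ.Unique-resp-↭ (setoid A) (↭⇒↭ₛ p)

  Closed-↭ : ∀ {xs ys} → xs ↭ ys → Closed xs → Closed ys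
  Closed-↭ p closed x∈ with closed (∈-resp-↭ (↭-sym p) x∈)
  ... | y , y∈ , Rxy = y , ∈-resp-↭ p y∈ , Rxy

  Unique-head : ∀ {x y} {xs : List A} → Unique (x ∷ xs) → y ∈ xs → x ≢ y
  Unique-head (x≢ ∷ _) y∈ = All.lookup x≢ y∈

  -- If the deleted `x` were the partner of a remaining `z`, symmetry would make `z` a partner of
  -- `x`, hence equal to `x`, against uniqueness.
  remove-fixed : ∀ {x xs} → Unique (x ∷ xs) → R x x → Closed (x ∷ xs) → Closed xs
  remove-fixed u Rxx closed z∈ with closed (there z∈)
  ... | w , there w∈   , Rzw = w , w∈ , Rzw
  ... | _ , here refl  , Rzx = contradiction (R-functional Rxx (R-sym Rzx)) (Unique-head u z∈)

  remove-pair : ∀ {x y xs} → Unique (x ∷ y ∷ xs) → R x y → Closed (x ∷ y ∷ xs) → Closed xs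
  remove-pair u@(_ ∷ v) Rxy closed z∈ with closed (there (there z∈))
  ... | w , there (there w∈)  , Rzw = w , w∈ , Rzw
  ... | _ , here refl         , Rzx = contradiction (R-functional Rxy (R-sym Rzx)) (Unique-head v z∈)
  ... | _ , there (here refl) , Rzy = contradiction (R-functional (R-sym Rxy) (R-sym Rzy)) (Unique-head u (there z∈))

  -- Each round deletes the first element together with its partner, which differs from it.
  even-length : ∀ {xs} → Unique xs → Closed xs → (∀ {x} → x ∈ xs → ¬ R x x) → length xs % 2 ≡ 0
  even-length {xs} = go (length xs) ≤-refl
    where
    -- The bound `n` drives the recursion, because the rest `ys` comes from a permutation and is no
    -- structural part of the list.
    go : ∀ n {xs} → length xs ≤ n → Unique xs → Closed xs → (∀ {x} → x ∈ xs → ¬ R x x) →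
         length xs % 2 ≡ 0
    go n       {[]}     _       _ _ _ = refl
    go (suc n) {x ∷ xs} (s≤s l) u closed free with closed (here refl)
    ... | _ , here refl , Rxx = contradiction Rxx (free (here refl))
    ... | y , there y∈  , Rxy with extract y∈
    ...   | ys , p = begin
      length (x ∷ xs) % 2      ≡⟨ cong (_% 2) (cong suc (↭-length p)) ⟩
      (2 + length ys) % 2      ≡⟨ cong (_% 2) (+-comm 2 (length ys)) ⟩
      (length ys + 2) % 2      ≡⟨ [m+n]%n≡m%n (length ys) 2 ⟩
      length ys % 2            ≡⟨ go n (≤-trans (n≤1+n _) (≤-trans (≤-reflexive (sym (↭-length p))) l))
                                    (AllPairs.tail (AllPairs.tail u′)) (remove-pair u′ Rxy closed′) free′ ⟩
      0                        ∎
      where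
      open ≡-Reasoning
      u′ : Unique (x ∷ y ∷ ys)
      u′ = Unique-↭ (prep x p) u
      closed′ : Closed (x ∷ y ∷ ys)
      closed′ = Closed-↭ (prep x p) closed
      free′ : ∀ {z} → z ∈ ys → ¬ R z z
      free′ z∈ = free (∈-resp-↭ (↭-sym (prep x p)) (there (there z∈)))

  -- Once the only fixed point is moved to the front and deleted, an even number of elements
  -- remains.
  odd-length : ∀ {xs x} → Unique xs → Closed xs → x ∈ xs → R x x → (∀ {z} → z ∈ xs → R z z → x ≡ z) →
               length xs % 2 ≡ 1
  odd-length {xs} {x} u closed x∈ Rxx only with extract x∈
  ... | ys , p = begin
    length xs % 2          ≡⟨ cong (_% 2) (↭-length p) ⟩
    (1 + length ys) % 2    ≡⟨ %-distribˡ-+ 1 (length ys) 2 ⟩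
    (1 + length ys % 2) % 2  ≡⟨ cong (λ r → (1 + r) % 2) (even-length (AllPairs.tail u′)
                              (remove-fixed u′ Rxx (Closed-↭ p closed))
                              λ z∈ Rzz → Unique-head u′ z∈ (only (∈-resp-↭ (↭-sym p) (there z∈)) Rzz)) ⟩
    1                      ∎
    where
    open ≡-Reasoning
    u′ : Unique (x ∷ ys)
    u′ = Unique-↭ p u

-- Conjugation on the list of 4-cores

cores : ℕ → List (List ℕ)
cores n = filter (isCore? 4) (partitions n)

cores-unique : ∀ n → Unique (cores n)
cores-unique n = Uniqueₚ.filter⁺ (isCore? 4) (partitions-unique n)

∈cores⇒Abacus : ∀ n {xs} → xs ∈ cores n → ∃ λ t → Abacus t xs × Weight t n
∈cores⇒Abacus n {xs} xs∈ with ∈-filter⁻ (isCore? 4) {xs = partitions n} xs∈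
... | xs∈p , core with partitions-sound {n} xs∈p
...   | isP with core⇒Abacus (Linked⇒AllPairs (λ y≤x z≤y → ≤-trans z≤y y≤x) (IsPartition.decreasing isP))
                             (IsPartition.positive isP) core
...     | t , ab = t , ab , subst (Weight t) (IsPartition.total isP) (Abacus-Weight ab)

Abacus⇒∈cores : ∀ n {t xs} → Abacus t xs → Weight t n → xs ∈ cores n
Abacus⇒∈cores n {t} ab w = ∈-filter⁺ (isCore? 4) (partitions-complete {n} record
  { total      = Weight-unique t (Abacus-Weight ab) w
  ; positive   = Abacus-positive ab
  ; decreasing = Abacus-decreasing ab
  }) (Abacus-core ab)

-- Conjugation carried over from triples to partitions, in the relational form that `Pairing`
-- expects.
record Dual (xs ys : List ℕ) : Set where
  constructor dual
  field
    {state state′} : State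
    abacus  : Abacus state xs
    conj    : Conj state state′
    abacus′ : Abacus state′ ys

Dual-sym : ∀ {xs ys} → Dual xs ys → Dual ys xs
Dual-sym (dual ab cj ab′) = dual ab′ (Conj-sym cj) ab

Dual-functional : ∀ {xs ys zs} → Dual xs ys → Dual xs zs → ys ≡ zs
Dual-functional (dual ab cj ab′) (dual ab₁ cj₁ ab₁′) with Abacus-unique-state ab ab₁
... | refl with Conj-functional cj cj₁
...   | refl = Abacus-unique-list ab′ ab₁′

Dual-refl⇒SelfConj : ∀ {t xs} → Abacus t xs → Dual xs xs → ∃₂ (SelfConj t)
Dual-refl⇒SelfConj ab (dual ab₁ cj ab₁′) with Abacus-unique-state ab ab₁ | Abacus-unique-state ab ab₁′
... | refl | refl = Conj⇒SelfConj cj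

open Pairing Dual Dual-sym Dual-functional

cores-closed : ∀ n → Closed (cores n)
cores-closed n xs∈ with ∈cores⇒Abacus n xs∈
... | t , ab , w with Conj-exists t
...   | t′ , cj with Abacus-exists t′
...     | ys , ab′ = ys , Abacus⇒∈cores n ab′ (Conj-Weight {n = n} cj w) , dual ab cj ab′

a₄-even : ∀ n → (∀ X Y → X * X + 4 * (Y * Y) ≢ 8 * n + 5) → a 4 n % 2 ≡ 0
a₄-even n no-squares = even-length (cores-unique n) (cores-closed n) free
  where
  free : ∀ {xs} → xs ∈ cores n → ¬ Dual xs xs
  free xs∈ d with ∈cores⇒Abacus n xs∈
  ... | t , ab , w with Dual-refl⇒SelfConj ab d
  ...   | X , Y , sc = no-squares X Y (Weight⇒squares {n = n} sc w)

-- Uniqueness of the solution and `SelfConj-injective` identify every self-conjugate core with the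
-- one built from `X` and `Y`.
a₄-odd : ∀ n {t X Y} → SelfConj t X Y → X * X + 4 * (Y * Y) ≡ 8 * n + 5 →
         (∀ X′ Y′ → X′ * X′ + 4 * (Y′ * Y′) ≡ 8 * n + 5 → X′ ≡ X × Y′ ≡ Y) → a 4 n % 2 ≡ 1
a₄-odd n {t} sc eq unique with Abacus-exists t
... | xs , ab = odd-length (cores-unique n) (cores-closed n)
    (Abacus⇒∈cores n ab (squares⇒Weight {n = n} sc eq)) (dual ab (SelfConj⇒Conj sc) ab) only
  where
  only : ∀ {zs} → zs ∈ cores n → Dual zs zs → xs ≡ zs
  only zs∈ d with ∈cores⇒Abacus n zs∈
  ... | t′ , ab′ , w′ with Dual-refl⇒SelfConj ab′ d
  ...   | X′ , Y′ , sc′ with unique X′ Y′ (Weight⇒squares {n = n} sc′ w′)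
  ...     | refl , refl with SelfConj-injective sc sc′
  ...       | refl = Abacus-unique-list ab ab′

-- Descent modulo 3

3*m+1≢3*n : ∀ m n → 3 * m + 1 ≢ 3 * n
3*m+1≢3*n m n eq with trans (sym (3*m+r%3 m 1)) (trans (cong (_% 3) eq) (trans (cong (_% 3) (*-comm 3 n)) (m*n%n≡0 n 3)))
  where
  3*m+r%3 : ∀ m r → (3 * m + r) % 3 ≡ r % 3
  3*m+r%3 m r = trans (cong (_% 3) (trans (+-comm (3 * m) r) (cong (r +_) (*-comm 3 m)))) ([m+kn]%n≡m%n r m 3)
... | ()

-- Doubling reduces the remainder 2 to the remainder 1.
3*m+2≢3*n : ∀ m n → 3 * m + 2 ≢ 3 * n
3*m+2≢3*n m n eq = 3*m+1≢3*n (m + m + 1) (2 * n) (trans (double m) (trans (cong (2 *_) eq) (double′ n)))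
  where
  double : ∀ m → 3 * (m + m + 1) + 1 ≡ 2 * (3 * m + 2)
  double = solve-∀
  double′ : ∀ n → 2 * (3 * n) ≡ 3 * (2 * n)
  double′ = solve-∀

square-mod-3 : ∀ X → (∃ λ x → X ≡ 3 * x) ⊎ (∃ λ k → X * X ≡ 3 * k + 1)
square-mod-3 0 = inj₁ (0 , refl)
square-mod-3 1 = inj₂ (0 , refl)
square-mod-3 2 = inj₂ (1 , refl)
square-mod-3 (suc (suc (suc X))) with square-mod-3 X
... | inj₁ (x , refl) = inj₁ (suc x , sym (*-suc 3 x))
... | inj₂ (k , eq)   = inj₂ (k + 2 * X + 3 , trans (expand X) (trans (cong (_+ (6 * X + 9)) eq) (collect k X)))
  where
  expand : ∀ X → (3 + X) * (3 + X) ≡ X * X + (6 * X + 9)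
  expand = solve-∀
  collect : ∀ k X → 3 * k + 1 + (6 * X + 9) ≡ 3 * (k + 2 * X + 3) + 1
  collect = solve-∀

-- Squares are 0 or 1 modulo 3 and 4 leaves 1, so unless 3 divides both numbers the sum leaves 1 or
-- 2.
3∣squares : ∀ X Y M → X * X + 4 * (Y * Y) ≡ 3 * M → (∃ λ x → X ≡ 3 * x) × (∃ λ y → Y ≡ 3 * y)
3∣squares X Y M eq with square-mod-3 X | square-mod-3 Y
... | inj₁ x∣ | inj₁ y∣ = x∣ , y∣
... | inj₁ (x , refl) | inj₂ (l , eqY) = contradiction
    (trans (sym (trans (cong (λ z → 3 * x * (3 * x) + 4 * z) eqY) (identity x l))) eq) (3*m+1≢3*n (3 * (x * x) + 4 * l + 1) M)
  where
  identity : ∀ x l → 3 * x * (3 * x) + 4 * (3 * l + 1) ≡ 3 * (3 * (x * x) + 4 * l + 1) + 1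
  identity = solve-∀
... | inj₂ (k , eqX) | inj₁ (y , refl) = contradiction
    (trans (sym (trans (cong (_+ 4 * (3 * y * (3 * y))) eqX) (identity k y))) eq) (3*m+1≢3*n (k + 12 * (y * y)) M)
  where
  identity : ∀ k y → 3 * k + 1 + 4 * (3 * y * (3 * y)) ≡ 3 * (k + 12 * (y * y)) + 1
  identity = solve-∀
... | inj₂ (k , eqX) | inj₂ (l , eqY) = contradiction
    (trans (sym (trans (cong₂ (λ u v → u + 4 * v) eqX eqY) (identity k l))) eq) (3*m+2≢3*n (k + 4 * l + 1) M)
  where
  identity : ∀ k l → 3 * k + 1 + 4 * (3 * l + 1) ≡ 3 * (k + 4 * l + 1) + 2
  identity = solve-∀

-- Once 3 divides `X` and `Y`, the left side is divisible by 9, so cancelling one 3 leaves another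
-- one in `M`.
descend : ∀ X Y M → X * X + 4 * (Y * Y) ≡ 3 * M →
          ∃₂ λ x y → X ≡ 3 * x × Y ≡ 3 * y × 3 * (x * x + 4 * (y * y)) ≡ M
descend X Y M eq with 3∣squares X Y M eq
... | (x , refl) , (y , refl) = x , y , refl , refl , *-cancelˡ-≡ (3 * (x * x + 4 * (y * y))) M 3 (trans (identity x y) eq)
  where
  identity : ∀ x y → 3 * (3 * (x * x + 4 * (y * y))) ≡ 3 * x * (3 * x) + 4 * (3 * y * (3 * y))
  identity = solve-∀

descend-9 : ∀ X Y M → X * X + 4 * (Y * Y) ≡ 9 * M →
            ∃₂ λ x y → X ≡ 3 * x × Y ≡ 3 * y × x * x + 4 * (y * y) ≡ M
descend-9 X Y M eq with descend X Y (3 * M) (trans eq (*-assoc 3 3 M))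
... | x , y , X≡ , Y≡ , eq′ = x , y , X≡ , Y≡ , *-cancelˡ-≡ (x * x + 4 * (y * y)) M 3 eq′

-- Each step divides `X` and `Y` by 3 and strips off a factor 9. At the end `3 * m` would be
-- divisible by 9.
no-squares : ∀ k m → (∀ n → m ≢ 3 * n) → ∀ X Y → X * X + 4 * (Y * Y) ≢ 9 ^ k * (3 * m)
no-squares zero m 3∤m X Y eq =
  let x , y , _ , _ , eq′ = descend X Y m (trans eq (*-identityˡ (3 * m)))
  in 3∤m (x * x + 4 * (y * y)) (sym eq′)
no-squares (suc k) m 3∤m X Y eq =
  let x , y , _ , _ , eq′ = descend-9 X Y (9 ^ k * (3 * m)) (trans eq (*-assoc 9 (9 ^ k) (3 * m)))
  in no-squares k m 3∤m x y eq′

-- Solutions of X² + 4Y² = 5 · 9^k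

squares≡5 : ∀ X Y → X * X + 4 * (Y * Y) ≡ 5 → X ≡ 1 × Y ≡ 1
squares≡5 1 1 _ = refl , refl
squares≡5 0 0 ()
squares≡5 1 0 ()
squares≡5 2 0 ()
squares≡5 0 1 ()
-- Here X² ≥ 9; in the last clause 4Y² ≥ 16.
squares≡5 (suc (suc (suc X))) Y eq = contradiction eq (>⇒≢ (≤-trans (s≤s (s≤s (s≤s (s≤s (s≤s (s≤s z≤n))))))
  (≤-trans (*-mono-≤ (m≤m+n 3 X) (m≤m+n 3 X)) (m≤m+n ((3 + X) * (3 + X)) _))))
squares≡5 2 1 ()
squares≡5 X (suc (suc Y)) eq = contradiction eq (>⇒≢ (≤-trans (s≤s (s≤s (s≤s (s≤s (s≤s (s≤s z≤n))))))
  (≤-trans (*-monoʳ-≤ 4 (*-mono-≤ (m≤m+n 2 Y) (m≤m+n 2 Y))) (m≤n+m _ (X * X)))))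

squares≡9^k*5 : ∀ k X Y → X * X + 4 * (Y * Y) ≡ 9 ^ k * 5 → X ≡ 3 ^ k × Y ≡ 3 ^ k
squares≡9^k*5 zero X Y eq = squares≡5 X Y eq
squares≡9^k*5 (suc k) X Y eq =
  let x , y , X≡3x , Y≡3y , eq′ = descend-9 X Y (9 ^ k * 5) (trans eq (*-assoc 9 (9 ^ k) 5))
      x≡ , y≡ = squares≡9^k*5 k x y eq′
  in trans X≡3x (cong (3 *_) x≡) , trans Y≡3y (cong (3 *_) y≡)

3^k-squares : ∀ k → 3 ^ k * 3 ^ k + 4 * (3 ^ k * 3 ^ k) ≡ 9 ^ k * 5
3^k-squares zero = refl
3^k-squares (suc k) = trans (identity (3 ^ k)) (trans (cong (9 *_) (3^k-squares k)) (sym (*-assoc 9 (9 ^ k) 5)))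
  where
  identity : ∀ p → 3 * p * (3 * p) + 4 * (3 * p * (3 * p)) ≡ 9 * (p * p + 4 * (p * p))
  identity = solve-∀

3^k-mod-4 : ∀ k → (∃ λ j → 3 ^ k ≡ 4 * j + 1) ⊎ (∃ λ j → 3 ^ k ≡ 4 * j + 3)
3^k-mod-4 zero = inj₁ (0 , refl)
3^k-mod-4 (suc k) with 3^k-mod-4 k
... | inj₁ (j , eq) = inj₂ (3 * j , trans (cong (3 *_) eq) (identity j))
  where
  identity : ∀ j → 3 * (4 * j + 1) ≡ 4 * (3 * j) + 3
  identity = solve-∀
... | inj₂ (j , eq) = inj₁ (3 * j + 2 , trans (cong (3 *_) eq) (identity j))
  where
  identity : ∀ j → 3 * (4 * j + 3) ≡ 4 * (3 * j + 2) + 1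
  identity = solve-∀

-- The residue of `3 ^ k` modulo 4 selects the constructor, and `Y = X` fixes `b`: `2 * b + 1`
-- equals `4 * j + 1` or `4 * j + 3`.
SelfConj-3^k : ∀ k → ∃ λ t → SelfConj t (3 ^ k) (3 ^ k)
SelfConj-3^k k with 3^k-mod-4 k
... | inj₁ (j , eq) = _ , self₁ {a = j} {b = 2 * j} eq (trans eq (cong (_+ 1) (*-assoc 2 2 j)))
... | inj₂ (j , eq) = _ , self₃ {b = 2 * j + 1} {c = j} eq (trans eq (identity j))
  where
  identity : ∀ j → 4 * j + 3 ≡ 2 * (2 * j + 1) + 1
  identity = solve-∀

-- The two congruences

3^2k : ∀ k → 3 ^ (2 * k) ≡ 9 ^ k
3^2k k = sym (^-*-assoc 3 2 k)

-- For the argument `N`, the number `8 * N + 5` is `9 ^ k * 3` times a number not divisible by 3, so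
-- 3 occurs in it to an odd power.
first-congruence : ∀ k n i → (∀ m → 24 * n + (8 * i + 15) ≢ 3 * m) →
  a 4 (3 ^ (2 * suc k) * n + ((8 * i + 15) * 3 ^ (2 * suc k ∸ 1) ∸ 5) / 8) % 2 ≡ 0
first-congruence k n i 3∤ = a₄-even N λ X Y eq → no-squares k (24 * n + (8 * i + 15)) 3∤ X Y (trans eq 8N+5)
  where
  q N : ℕ
  q = ((8 * i + 15) * 3 ^ (2 * suc k ∸ 1) ∸ 5) / 8
  N = 3 ^ (2 * suc k) * n + q
  open ≡-Reasoning
  expand : ∀ p n q → 8 * (p * n + q) + 5 ≡ 8 * (p * n) + (8 * q + 5)
  expand = solve-∀
  collect : ∀ p n s → 8 * (9 * p * n) + s * (3 * p) ≡ p * (3 * (24 * n + s))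
  collect = solve-∀
  3^[2k+1] : 3 ^ (2 * suc k ∸ 1) ≡ 3 * 9 ^ k
  3^[2k+1] = trans (cong (λ e → 3 ^ (e ∸ 1)) (*-suc 2 k)) (cong (3 *_) (3^2k k))
  8N+5 : 8 * N + 5 ≡ 9 ^ k * (3 * (24 * n + (8 * i + 15)))
  8N+5 = begin
    8 * N + 5
      ≡⟨ expand (3 ^ (2 * suc k)) n q ⟩
    8 * (3 ^ (2 * suc k) * n) + (8 * q + 5)
      ≡⟨ cong (8 * (3 ^ (2 * suc k) * n) +_) (offset₁-exact (suc k) i (s≤s z≤n)) ⟩
    8 * (3 ^ (2 * suc k) * n) + (8 * i + 15) * 3 ^ (2 * suc k ∸ 1)
      ≡⟨ cong₂ (λ u v → 8 * (u * n) + (8 * i + 15) * v) (3^2k (suc k)) 3^[2k+1] ⟩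
    8 * (9 * 9 ^ k * n) + (8 * i + 15) * (3 * 9 ^ k)
      ≡⟨ collect (9 ^ k) n (8 * i + 15) ⟩
    9 ^ k * (3 * (24 * n + (8 * i + 15))) ∎

second-congruence : ∀ k → a 4 ((5 * 3 ^ (2 * k) ∸ 5) / 8) % 2 ≡ 1
second-congruence k = a₄-odd N (proj₂ (SelfConj-3^k k)) (trans (3^k-squares k) (sym 8N+5))
  λ X Y eq → squares≡9^k*5 k X Y (trans eq 8N+5)
  where
  N : ℕ
  N = (5 * 3 ^ (2 * k) ∸ 5) / 8
  8N+5 : 8 * N + 5 ≡ 9 ^ k * 5
  8N+5 = trans (offset₂-exact k) (trans (cong (5 *_) (3^2k k)) (*-comm 5 (9 ^ k)))

mainTheorem8 : ((α n i : ℕ) → 1 ≤ α → i ≡ 1 ⊎ i ≡ 2 →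
    a 4 (3 ^ (2 * α) * n + ((8 * i + 15) * 3 ^ (2 * α ∸ 1) ∸ 5) / 8) % 2 ≡ 0)
    × ((β : ℕ) → a 4 ((5 * 3 ^ (2 * β) ∸ 5) / 8) % 2 ≡ 1)
mainTheorem8 = first , second-congruence
  where
  -- Modulo 3, `8 * i + 15` is `2 * i`, so `i = 1` and `i = 2` leave the remainders 2 and 1.
  rem₁ : ∀ n → 24 * n + 23 ≡ 3 * (8 * n + 7) + 2
  rem₁ = solve-∀
  rem₂ : ∀ n → 24 * n + 31 ≡ 3 * (8 * n + 10) + 1
  rem₂ = solve-∀
  first : (α n i : ℕ) → 1 ≤ α → i ≡ 1 ⊎ i ≡ 2 →
    a 4 (3 ^ (2 * α) * n + ((8 * i + 15) * 3 ^ (2 * α ∸ 1) ∸ 5) / 8) % 2 ≡ 0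
  first (suc k) n 1 _ (inj₁ refl) = first-congruence k n 1 λ m eq → 3*m+2≢3*n (8 * n + 7) m (trans (sym (rem₁ n)) eq)
  first (suc k) n 2 _ (inj₂ refl) = first-congruence k n 2 λ m eq → 3*m+1≢3*n (8 * n + 10) m (trans (sym (rem₂ n)) eq)
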